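{- Let $n,k\in\mathbb N$ with $k\ge 5$. Then $$\tilde r(P_k,P_n)\le \frac53 n+12k.$$
   Context: $P_t$ denotes the path on $t$ vertices and $\mathbb N$ the set of positive integers. For finite graphs $G,H$, the game $\tilde R(G,H)$ is played by Builder and Painter on the infinite complete graph $K_{\mathbb N}$ with vertex set $\mathbb N$: in every round Builder chooses a previously unselected edge of $K_{\mathbb N}$ and Painter colours it red or blue. The game ends when there is a red copy of $G$ or a blue copy of $H$ (as a not necessarily induced subgraph) on the board. Builder aims to finish the game as soon as possible, Painter aims to prolong it. The online size Ramsey number $\tilde r(G,H)$ is the number of rounds in $\tilde R(G,H)$ when both players play optimally, i.e. the least $t$ such that Builder has a strategy guaranteeing that the game ends within at most $t$ rounds whatever Painter does. -}

module Defs where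

open import Data.Fin using (Fin; toℕ)
open import Data.List using (List; []; _∷_)
open import Data.List.Membership.Propositional using (_∈_)
open import Data.Nat using (ℕ; suc; _≤_)
open import Data.Nat.Properties using (1+n≢n)
open import Data.Product using (Σ; ∃; _×_; _,_)
open import Data.Sum using (_⊎_; inj₁; inj₂; swap)
open import Function.Definitions using (Injective)
open import Relation.Binary.PropositionalEquality using (_≡_; _≢_)
open import Relation.Nullary using (¬_)

record FiniteGraph : Set₁ where
  field
    order  : ℕ
    Adj    : Fin order → Fin order → Set
    symm   : ∀ {i j} → Adj i j → Adj j i
    irrefl : ∀ {i} → ¬ Adj i i

-- P t has t vertices (hence t ∸ 1 edges).
P : ℕ → FiniteGraph
P t = record
  { order  = t
  ; Adj    = λ i j → suc (toℕ i) ≡ toℕ j ⊎ suc (toℕ j) ≡ toℕ i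
  ; symm   = swap
  ; irrefl = λ { (inj₁ e) → 1+n≢n e ; (inj₂ e) → 1+n≢n e }
  }

data Colour : Set where
  red blue : Colour

-- A position of the game: the edges selected so far with their colours, most
-- recent first.  The vertices of the infinite complete graph are indexed from
-- 0 instead of 1.  The entry (u , v , c) stands for the unordered edge {u , v};
-- u ≢ v is enforced when the edge is played, see `play` below.
Board : Set
Board = List (ℕ × ℕ × Colour)

HasEdge : Board → Colour → ℕ → ℕ → Set
HasEdge B c u v = (u , v , c) ∈ B ⊎ (v , u , c) ∈ B

Selected : Board → ℕ → ℕ → Set
Selected B u v = ∃ λ c → HasEdge B c u v

-- A not necessarily induced copy of G in colour c.
HasCopy : Board → Colour → FiniteGraph → Set
HasCopy B c G =
  Σ (Fin order → ℕ) λ f →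
    Injective _≡_ _≡_ f × (∀ i j → Adj i j → HasEdge B c (f i) (f j))
  where open FiniteGraph G

GameOver : FiniteGraph → FiniteGraph → Board → Set
GameOver G H B = HasCopy B red G ⊎ HasCopy B blue H

-- A strategy tree for Builder that, from position B, ends the game within at
-- most t further rounds against every choice of colours by Painter.
data Strategy (G H : FiniteGraph) : ℕ → Board → Set where
  over : ∀ {t B} → GameOver G H B → Strategy G H t B
  play : ∀ {t B} (u v : ℕ) → u ≢ v → ¬ Selected B u v →
         (∀ c → Strategy G H t ((u , v , c) ∷ B)) →
         Strategy G H (suc t) B

BuilderWinsWithin : FiniteGraph → FiniteGraph → ℕ → Set
BuilderWinsWithin G H t = Strategy G H t []

-- The graph of the partial function r̃: that r = r̃(G,H).
IsOnlineSizeRamsey : FiniteGraph → FiniteGraph → ℕ → Set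
IsOnlineSizeRamsey G H r =
  BuilderWinsWithin G H r × (∀ t → BuilderWinsWithin G H t → r ≤ t)

{-# OPTIONS --safe #-}
module Submission where

-- A stack is a list of vertex-disjoint blue paths (pieces) whose heads form a
-- red path, so that it never has k pieces.  Builder runs two stacks.
--
-- The supply stack consists of single vertices and single blue edges; its top
-- head g is joined to fresh vertices.  A red answer pushes the fresh vertex, two
-- blue answers u, x turn g into a blue path u g x, which leaves the stack.  This
-- costs three rounds for each new three-vertex path.
--
-- A new path L is attached to the storage stack by joining its head to the top
-- head.  A red answer pushes L, a blue one pops a piece and merges it with L.
-- There are at most as many merges, and at most as many pushes, as new paths; so
-- all this takes five rounds for every three vertices, plus O(k) rounds for what
-- is left in the supply stack.
--
-- Once the pieces have n + k vertices, the at most k pieces are merged in O(k)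
-- rounds at the cost of fewer than k vertices: every one or two rounds either
-- lengthen a red path by a vertex cut off a piece, or merge two pieces, possibly
-- using up the end of that red path.
--
-- The least number of rounds exists because it is decidable whether Builder
-- wins within t rounds: up to relabelling there are finitely many moves.

open import Data.List
  using (List; []; _∷_; [_]; _++_; _ʳ++_; concat; concatMap; length; lookup; map)
open import Data.Product using (∃; _×_; _,_; proj₁; proj₂)
open import Relation.Binary.PropositionalEquality hiding ([_])
open import Defs

-- Potential functions for the two stages.

module Budgets where

  open import Data.Nat
  open import Data.Nat.Properties
  open import Data.Nat.Tactic.RingSolver using (solve)

  -- Certificates for linear inequalities: a + x and b + x are, up to a slack of
  -- s, the two sides of a nonnegative combination of the hypotheses.
  linear : ∀ x s {a b l r} → l ≤ r → a + x ≡ l → r + s ≡ b + x → a ≤ b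
  linear x s {a} {b} l≤r refl eq =
    +-cancelʳ-≤ x a b (≤-trans (≤-trans l≤r (m≤m+n _ s)) (≤-reflexive eq))

  infixl 6 _⊕_
  infixl 7 _⊛_

  _⊕_ : ∀ {a b c d} → a ≤ b → c ≤ d → a + c ≤ b + d
  _⊕_ = +-mono-≤

  _⊛_ : ∀ c {a b} → a ≤ b → c * a ≤ c * b
  c ⊛ a≤b = *-monoʳ-≤ c a≤b

  module Budget (k n : ℕ) where

    -- The potential of the second stage: t rounds are left, the red path has j
    -- vertices and q + 1 pieces are to be merged.
    record MergeBudget (t j q : ℕ) : Set where
      constructor ⟨_⟩
      field bound : 4 * q + 2 * k ≤ t + 2 * j

    -- The potential of the first stage: t rounds are left, h pieces with v
    -- vertices are stored, g vertices are in the supply stack; b = 6 while a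
    -- piece is being attached (its vertices are counted by v) and b = 0 otherwise.
    record GrowBudget (b t h v g : ℕ) : Set where
      constructor ⟨_⟩
      field bound : 5 * n + 35 * k + 3 * h + b ≤ 3 * t + 5 * v + 3 * g

    -- Abstract because `with` would otherwise normalise the certificates.
    abstract

      merge-2≤t : ∀ {t j q} → j < k → MergeBudget t j q → 2 ≤ t
      merge-2≤t {t} {j} {q} j<k ⟨ le ⟩ =
        linear (4 * q + 2 * j + 2 * k) (4 * q) (le ⊕ 2 ⊛ j<k)
          (solve (j ∷ k ∷ q ∷ [])) (solve (j ∷ k ∷ t ∷ q ∷ []))

      merge-drop : ∀ {t j q} → MergeBudget t j (suc q) → MergeBudget t j q
      merge-drop {t} {j} {q} ⟨ le ⟩ =
        ⟨ linear 4 4 le (solve (k ∷ q ∷ [])) (solve (t ∷ j ∷ [])) ⟩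

      merge-push : ∀ {t j q} → MergeBudget (2 + t) j q → MergeBudget t (suc j) q
      merge-push {t} {j} {q} ⟨ le ⟩ =
        ⟨ linear 0 0 le (solve (k ∷ q ∷ [])) (solve (t ∷ j ∷ [])) ⟩

      -- Why a piece has weight 4: merging it pays 2 for the two rounds and 2 for the vertex that
      -- the red path loses.
      merge-pop : ∀ {t j q} → MergeBudget (2 + t) (suc j) (suc q) → MergeBudget t j q
      merge-pop {t} {j} {q} ⟨ le ⟩ =
        ⟨ linear 4 0 le (solve (k ∷ q ∷ [])) (solve (t ∷ j ∷ [])) ⟩

      merge-join : ∀ {t j q} → MergeBudget (2 + t) j (suc q) → MergeBudget t j q
      merge-join {t} {j} {q} ⟨ le ⟩ =
        ⟨ linear 4 2 le (solve (k ∷ q ∷ [])) (solve (t ∷ j ∷ [])) ⟩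

      merge-remainder : ∀ {j m} → j < k → n + k ≤ j + m → n ≤ m
      merge-remainder {j} {m} j<k le = linear (suc j + k) 1 (le ⊕ j<k)
        (solve (n ∷ j ∷ k ∷ [])) (solve (j ∷ m ∷ k ∷ []))

      grow-1≤t : ∀ {b t h v g} → v < n + k → g ≤ 2 * k → GrowBudget b t h v g → 1 ≤ t
      grow-1≤t {b} {t} {h} {v} {g} v< g≤ ⟨ le ⟩ = positive t
        (linear (5 * n + 35 * k + 3 * h + b + 5 * v + 4 + 3 * g) (24 * k + 3 * h + b + 4)
          (le ⊕ 5 ⊛ v< ⊕ 3 ⊛ g≤)
          (solve (n ∷ k ∷ h ∷ b ∷ v ∷ g ∷ [])) (solve (n ∷ k ∷ h ∷ b ∷ v ∷ g ∷ t ∷ [])))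
        where
        positive : ∀ t → 1 ≤ 3 * t → 1 ≤ t
        positive (suc t) _ = s≤s z≤n

      grow-supply : ∀ {b t h v g} → GrowBudget b (suc t) h v g → GrowBudget b t h v (suc g)
      grow-supply {b} {t} {h} {v} {g} ⟨ le ⟩ =
        ⟨ linear 0 0 le (solve (n ∷ k ∷ h ∷ b ∷ [])) (solve (t ∷ v ∷ g ∷ [])) ⟩

      grow-root : ∀ {b t h v g} → GrowBudget b t h v g → GrowBudget b t h v (suc g)
      grow-root {b} {t} {h} {v} {g} ⟨ le ⟩ =
        ⟨ linear 0 3 le (solve (n ∷ k ∷ h ∷ b ∷ [])) (solve (t ∷ v ∷ g ∷ [])) ⟩

      -- Three more stored vertices are worth 15. The round takes 3 of this and the two vertices
      -- leaving the supply stack take 6. The other 6 are reserved: 3 for the round of a push and 3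
      -- to be kept with the pushed piece.
      grow-piece : ∀ {t h v g} → GrowBudget 0 (suc t) h v (2 + g) → GrowBudget 6 t h (3 + v) g
      grow-piece {t} {h} {v} {g} ⟨ le ⟩ =
        ⟨ linear 0 0 (le ⊕ ≤-refl {6}) (solve (n ∷ k ∷ h ∷ [])) (solve (t ∷ v ∷ g ∷ [])) ⟩

      grow-push : ∀ {t h v g} → GrowBudget 6 (suc t) h v g → GrowBudget 0 t (suc h) v g
      grow-push {t} {h} {v} {g} ⟨ le ⟩ =
        ⟨ linear 3 0 le (solve (n ∷ k ∷ h ∷ [])) (solve (t ∷ v ∷ g ∷ [])) ⟩

      grow-store : ∀ {t h v g} → GrowBudget 6 t h v g → GrowBudget 0 t (suc h) v g
      grow-store {t} {h} {v} {g} ⟨ le ⟩ =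
        ⟨ linear 3 3 le (solve (n ∷ k ∷ h ∷ [])) (solve (t ∷ v ∷ g ∷ [])) ⟩

      -- The popped piece pays for the round with the 3 kept with it, so the reserve of 6 survives
      -- any number of merges.
      grow-pop : ∀ {t h v g} → GrowBudget 6 (suc t) (suc h) v g → GrowBudget 6 t h v g
      grow-pop {t} {h} {v} {g} ⟨ le ⟩ =
        ⟨ linear 3 0 le (solve (n ∷ k ∷ h ∷ [])) (solve (t ∷ v ∷ g ∷ [])) ⟩

      grow-drop : ∀ {t h v g} → GrowBudget 6 t h v g → GrowBudget 0 t h v g
      grow-drop {t} {h} {v} {g} ⟨ le ⟩ =
        ⟨ linear 6 6 le (solve (n ∷ k ∷ h ∷ [])) (solve (t ∷ v ∷ g ∷ [])) ⟩

      -- The term `35 * k` covers the excess of `v` over `n`, the vertices stranded in the supply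
      -- stack and the whole second stage.
      grow⇒merge : ∀ {t h v g} → v ≤ 2 + (n + k) → g ≤ 2 * k → h < k →
                   GrowBudget 6 t h v g → MergeBudget t 0 h
      grow⇒merge {t} {h} {v} {g} v≤ g≤ h< ⟨ le ⟩ = ⟨ *-cancelˡ-≤ 3
        (linear (5 * n + 29 * k + 15 + 5 * v + 3 * g) (9 * k + 5)
          (le ⊕ 5 ⊛ v≤ ⊕ 3 ⊛ g≤ ⊕ 9 ⊛ h<)
          (solve (n ∷ k ∷ h ∷ v ∷ g ∷ [])) (solve (n ∷ k ∷ h ∷ v ∷ g ∷ t ∷ []))) ⟩

      grow-start : ∀ {t} → 5 * n + 36 * k ≤ 2 + 3 * t → GrowBudget 0 t 0 0 1
      grow-start {t} le =
        ⟨ linear k (1 + k) le (solve (n ∷ k ∷ [])) (solve (k ∷ t ∷ [])) ⟩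

-- Deciding whether Builder wins within a given number of rounds.

module Decidability where

  open import Data.Fin as Fin using (Fin; toℕ)
  import Data.Fin.Properties as Fin
  open import Data.List.Membership.Propositional using (_∈_)
  open import Data.List.Membership.Propositional.Properties using (∈-map⁺; ∈-map⁻)
  open import Data.List.Properties using (map-id-local)
  import Data.List.Relation.Unary.All as All
  open import Data.List.Relation.Unary.Any using (here; there)
  open import Data.Nat
  open import Data.Nat.Properties
  import Data.Product.Properties as Product
  open import Data.Sum as Sum using (inj₁; inj₂)
  open import Data.Vec as Vec using (Vec; []; _∷_; tabulate)
  open import Data.Vec.Properties using (lookup∘tabulate)
  import Data.Vec.Relation.Unary.All as VecAll
  import Data.Vec.Relation.Unary.All.Properties as VecAll
  open import Function using (_∘_; Injective)
  open import Level using (0ℓ)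
  open import Relation.Binary.Definitions using (DecidableEquality)
  open import Relation.Nullary
  open import Relation.Nullary.Decidable using (map′; _×-dec_; _⊎-dec_; _→-dec_; ¬?)
  open import Relation.Unary using (Pred; Decidable)

  private
    variable
      G H : FiniteGraph
      B   : Board
      c   : Colour
      k t u v : ℕ

  least : {Q : Pred ℕ 0ℓ} → Decidable Q → ∀ t → Q t →
          ∃ λ r → r ≤ t × Q r × (∀ s → Q s → r ≤ s)
  least Q? t Qt with Q? 0
  ... | yes Q0 = 0 , z≤n , Q0 , λ _ _ → z≤n
  least Q? zero    Q0 | no ¬Q0 = contradiction Q0 ¬Q0
  least Q? (suc t) Qt | no ¬Q0 with least (Q? ∘ suc) t Qt
  ... | r , r≤t , Qr , min = suc r , s≤s r≤t , Qr ,
    λ { zero Q0 → contradiction Q0 ¬Q0 ; (suc s) Qs → s≤s (min s Qs) }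

  _≟ᶜ_ : DecidableEquality Colour
  red  ≟ᶜ red  = yes refl
  red  ≟ᶜ blue = no λ ()
  blue ≟ᶜ red  = no λ ()
  blue ≟ᶜ blue = yes refl

  open import Data.List.Membership.DecPropositional
    (Product.≡-dec _≟_ (Product.≡-dec _≟_ _≟ᶜ_)) using (_∈?_)

  hasEdge? : ∀ B c u v → Dec (HasEdge B c u v)
  hasEdge? B c u v = ((u , v , c) ∈? B) ⊎-dec ((v , u , c) ∈? B)

  selected? : ∀ B u v → Dec (Selected B u v)
  selected? B u v = map′ Sum.[ red ,_ , blue ,_ ]
    (λ { (red , e) → inj₁ e ; (blue , e) → inj₂ e })
    (hasEdge? B red u v ⊎-dec hasEdge? B blue u v)

  -- No label from `bound B` on occurs on the board, so these vertices are interchangeable.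
  bound : Board → ℕ
  bound []                = 0
  bound ((u , v , _) ∷ B) = suc u ⊔ (suc v ⊔ bound B)

  ∈⇒<bound : ∀ {u v c} → (u , v , c) ∈ B → u < bound B × v < bound B
  ∈⇒<bound {B = (a , b , _) ∷ B} (here refl) =
    m≤m⊔n (suc a) (suc b ⊔ bound B) , m≤n⇒m≤o⊔n (suc a) (m≤m⊔n (suc b) (bound B))
  ∈⇒<bound {B = (a , b , _) ∷ _} (there e) with ∈⇒<bound e
  ... | u< , v< = m≤n⇒m≤o⊔n (suc a) (m≤n⇒m≤o⊔n (suc b) u<)
                , m≤n⇒m≤o⊔n (suc a) (m≤n⇒m≤o⊔n (suc b) v<)

  hasEdge⇒<boundˡ : HasEdge B c u v → u < bound B
  hasEdge⇒<boundˡ (inj₁ e) = proj₁ (∈⇒<bound e)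
  hasEdge⇒<boundˡ (inj₂ e) = proj₂ (∈⇒<bound e)

  boundedVec? : ∀ m n {Q : Pred (Vec ℕ n) 0ℓ} → Decidable Q →
                Dec (∃ λ xs → VecAll.All (_< m) xs × Q xs)
  boundedVec? m zero    Q? = map′ (λ q → [] , VecAll.[] , q) (λ { ([] , _ , q) → q }) (Q? [])
  boundedVec? m (suc n) Q? =
    map′ (λ { (x , x<m , xs , xs<m , q) → x ∷ xs , x<m VecAll.∷ xs<m , q })
         (λ { (x ∷ xs , x<m VecAll.∷ xs<m , q) → x , x<m , xs , xs<m , q })
         (anyUpTo? (λ x → boundedVec? m n (Q? ∘ (x ∷_))) m)

  module _ (B : Board) (c : Colour) where

    IsPath : Vec ℕ k → Set
    IsPath {k} xs = (∀ i j → Vec.lookup xs i ≡ Vec.lookup xs j → i ≡ j) ×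
                    (∀ i j → FiniteGraph.Adj (P k) i j →
                       HasEdge B c (Vec.lookup xs i) (Vec.lookup xs j))

    isPath? : Decidable (IsPath {k})
    isPath? xs =
      Fin.all? (λ i → Fin.all? λ j → (Vec.lookup xs i ≟ Vec.lookup xs j) →-dec (i Fin.≟ j)) ×-dec
      Fin.all? (λ i → Fin.all? λ j →
        ((suc (toℕ i) ≟ toℕ j) ⊎-dec (suc (toℕ j) ≟ toℕ i)) →-dec hasEdge? B c _ _)

    -- On two or more vertices, each vertex of a path has a neighbour, so its image lies on the
    -- board. This makes the search for a copy finite.
    copy⇒boundedPath : HasCopy B c (P (2 + k)) →
                       ∃ λ xs → VecAll.All (_< bound B) xs × IsPath {2 + k} xs
    copy⇒boundedPath {k} (f , inj , edge) = tabulate f , VecAll.tabulate⁺ f<bound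
      , (λ i j eq → inj (trans (sym (lookup∘tabulate f i)) (trans eq (lookup∘tabulate f j))))
      , (λ i j adj → subst₂ (HasEdge B c) (sym (lookup∘tabulate f i)) (sym (lookup∘tabulate f j))
                       (edge i j adj))
      where
      f<bound : ∀ i → f i < bound B
      f<bound Fin.zero    = hasEdge⇒<boundˡ {B = B} (edge Fin.zero (Fin.suc Fin.zero) (inj₁ refl))
      f<bound (Fin.suc i) = hasEdge⇒<boundˡ {B = B} (edge (Fin.suc i) (Fin.inject₁ i)
                              (inj₂ (cong suc (Fin.toℕ-inject₁ i))))

    hasCopy? : ∀ k → Dec (HasCopy B c (P k))
    hasCopy? zero          = yes ((λ _ → 0) , (λ { {()} }) , λ ())
    hasCopy? (suc zero)    = yes ((λ _ → 0) , (λ { {Fin.zero} {Fin.zero} _ → refl }) ,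
      λ { Fin.zero Fin.zero adj → contradiction adj (FiniteGraph.irrefl (P 1) {Fin.zero}) })
    hasCopy? (suc (suc k)) =
      map′ (λ { (xs , _ , inj , edge) → Vec.lookup xs , inj _ _ , edge })
           copy⇒boundedPath
           (boundedVec? (bound B) (2 + k) isPath?)

  -- Relabelling vertices.

  relabel : (ℕ → ℕ) → Board → Board
  relabel σ = map λ { (u , v , c) → σ u , σ v , c }

  module _ {σ : ℕ → ℕ} where

    hasEdge-relabel : HasEdge B c u v → HasEdge (relabel σ B) c (σ u) (σ v)
    hasEdge-relabel = Sum.map (∈-map⁺ _) (∈-map⁺ _)

    hasCopy-relabel : Injective _≡_ _≡_ σ → HasCopy B c G → HasCopy (relabel σ B) c G
    hasCopy-relabel {B = B} σ-inj (f , inj , edge) =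
      σ ∘ f , inj ∘ σ-inj , λ i j adj → hasEdge-relabel {B = B} (edge i j adj)

    ∈-relabel⁻ : Injective _≡_ _≡_ σ → (σ u , σ v , c) ∈ relabel σ B → (u , v , c) ∈ B
    ∈-relabel⁻ {B = B} σ-inj e with ∈-map⁻ _ {xs = B} e
    ... | (u′ , v′ , c′) , e′ , eq
      with refl ← σ-inj (cong proj₁ eq)
         | refl ← σ-inj (cong (proj₁ ∘ proj₂) eq)
         | refl ← cong (proj₂ ∘ proj₂) eq = e′

    -- An injection carries copies to copies and never maps an unselected edge onto a selected one,
    -- so legal moves stay legal.
    strategy-relabel : Injective _≡_ _≡_ σ → Strategy G H t B → Strategy G H t (relabel σ B)
    strategy-relabel {G = G} {H = H} {B = B} σ-inj (over o) =
      over (Sum.map (hasCopy-relabel {B = B} {G = G} σ-inj)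
                    (hasCopy-relabel {B = B} {G = H} σ-inj) o)
    strategy-relabel {B = B} σ-inj (play u v u≢v unsel s) =
      play (σ u) (σ v) (u≢v ∘ σ-inj)
        (λ { (c , e) → unsel
             (c , Sum.map (∈-relabel⁻ {B = B} σ-inj) (∈-relabel⁻ {B = B} σ-inj) e) })
        (λ c → strategy-relabel σ-inj (s c))

  transposeℕ : ℕ → ℕ → ℕ → ℕ
  transposeℕ a b x with x ≟ a | x ≟ b
  ... | yes _ | _     = b
  ... | no _  | yes _ = a
  ... | no _  | no _  = x

  transposeℕ-a : ∀ a b → transposeℕ a b a ≡ b
  transposeℕ-a a b with a ≟ a | a ≟ b
  ... | yes _  | _ = refl
  ... | no a≢a | _ = contradiction refl a≢a

  transposeℕ-fixes : ∀ {a b x} → x ≢ a → x ≢ b → transposeℕ a b x ≡ x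
  transposeℕ-fixes {a} {b} {x} x≢a x≢b with x ≟ a | x ≟ b
  ... | yes x≡a | _       = contradiction x≡a x≢a
  ... | no _    | yes x≡b = contradiction x≡b x≢b
  ... | no _    | no _    = refl

  transposeℕ-injective : ∀ a b → Injective _≡_ _≡_ (transposeℕ a b)
  transposeℕ-injective a b {x} {y} eq with x ≟ a | x ≟ b | y ≟ a | y ≟ b
  ... | yes p | _     | yes q | _     = trans p (sym q)
  ... | yes p | _     | no _  | yes q = trans p (trans (sym eq) (sym q))
  ... | yes p | _     | no _  | no ¬q = contradiction (sym eq) ¬q
  ... | no ¬p | yes p | yes q | _     = contradiction (trans p (sym eq)) ¬p
  ... | no _  | yes p | no _  | yes q = trans p (sym q)
  ... | no _  | yes p | no ¬q | no _  = contradiction (sym eq) ¬q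
  ... | no _  | no ¬p | yes _ | _     = contradiction eq ¬p
  ... | no ¬p | no _  | no _  | yes _ = contradiction eq ¬p
  ... | no _  | no _  | no _  | no _  = eq

  module _ (G H : FiniteGraph) where

    Move : ℕ → Board → ℕ → ℕ → Set
    Move t B u v = u ≢ v × ¬ Selected B u v × (∀ c → Strategy G H t ((u , v , c) ∷ B))

    -- All labels on the board are fixed, so relabelling changes only the new edge.
    move-relabel : ∀ {σ} → Injective _≡_ _≡_ σ → (∀ {x} → x < bound B → σ x ≡ x) →
                   Move t B u v → Move t B (σ u) (σ v)
    move-relabel {B = B} {t = t} {u = u} {v = v} {σ = σ} σ-inj fixes (u≢v , unsel , s) =
      u≢v ∘ σ-inj
      , (λ { (c , e) → unsel (c , Sum.map (∈-relabel⁻ {B = B} σ-inj) (∈-relabel⁻ {B = B} σ-inj)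
                                    (subst (λ B → HasEdge B c (σ u) (σ v)) (sym fix) e)) })
      , λ c → subst (λ B → Strategy G H t ((σ u , σ v , c) ∷ B)) fix (strategy-relabel σ-inj (s c))
      where
      fix : relabel σ B ≡ B
      fix = map-id-local (All.tabulate λ {e} e∈B →
        cong₂ (λ u v → u , v , proj₂ (proj₂ e))
          (fixes (proj₁ (∈⇒<bound e∈B))) (fixes (proj₂ (∈⇒<bound e∈B))))

    move-boundˡ : Move t B u v → ∃ λ u′ → ∃ λ v′ → u′ ≤ bound B × Move t B u′ v′
    move-boundˡ {B = B} {u = u} {v} mv with u <? bound B
    ... | yes u< = u , v , <⇒≤ u< , mv
    ... | no u≮  = _ , _ , ≤-reflexive (transposeℕ-a u (bound B))
      , move-relabel (transposeℕ-injective u (bound B))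
          (λ x< → transposeℕ-fixes (λ { refl → u≮ x< }) (<⇒≢ x<)) mv

    -- An edge has at most two vertices off the board, and by symmetry `bound B` and `1 + bound B`
    -- can stand for them.
    move-bound : Move t B u v →
                 ∃ λ u′ → u′ < 2 + bound B × ∃ λ v′ → v′ < 2 + bound B × Move t B u′ v′
    move-bound {B = B} mv with move-boundˡ mv
    ... | u , v , u≤ , mv′ with v <? 2 + bound B
    ...   | yes v< = u , m<n⇒m<1+n (s≤s u≤) , v , v< , mv′
    -- The swap uses `1 + bound B` because `u` may equal `bound B` and has to stay fixed.
    ...   | no v≮  = u , m<n⇒m<1+n (s≤s u≤) , 1 + bound B , n<1+n _ ,
      subst₂ (Move _ B) (σ-fixes u≤) (transposeℕ-a v (1 + bound B))
        (move-relabel (transposeℕ-injective v (1 + bound B)) (σ-fixes ∘ <⇒≤) mv′)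
      where
      σ-fixes : ∀ {x} → x ≤ bound B → transposeℕ v (1 + bound B) x ≡ x
      σ-fixes x≤ = transposeℕ-fixes (λ { refl → v≮ (m<n⇒m<1+n (s≤s x≤)) }) (<⇒≢ (s≤s x≤))

  gameOver? : ∀ k n B → Dec (GameOver (P k) (P n) B)
  gameOver? k n B = hasCopy? B red k ⊎-dec hasCopy? B blue n

  strategy? : ∀ k n t B → Dec (Strategy (P k) (P n) t B)
  strategy? k n zero    B = map′ over (λ { (over o) → o }) (gameOver? k n B)
  strategy? k n (suc t) B =
    map′ Sum.[ over , (λ { (u , _ , v , _ , u≢v , unsel , s) → play u v u≢v unsel s }) ]
         (λ { (over o)               → inj₁ o
            ; (play u v u≢v unsel s) → inj₂ (move-bound (P k) (P n) (u≢v , unsel , s)) })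
         (gameOver? k n B ⊎-dec
          anyUpTo? (λ u → anyUpTo? (λ v → move? u v) (2 + bound B)) (2 + bound B))
    where
    move? : ∀ u v → Dec (Move (P k) (P n) t B u v)
    move? u v = ¬? (u ≟ v) ×-dec ¬? (selected? B u v) ×-dec
      map′ (λ { (r , b) → λ { red → r ; blue → b } }) (λ s → s red , s blue)
           (strategy? k n t ((u , v , red) ∷ B) ×-dec strategy? k n t ((u , v , blue) ∷ B))

-- Builder's strategy for two paths.

module BuilderStrategy where

  open import Data.Fin as Fin using (Fin; toℕ)
  import Data.Fin.Properties as Fin
  open import Data.List.Extrema.Nat using (max; xs≤max)
  open import Data.List.Membership.Propositional using (_∈_)
  open import Data.List.Membership.Propositional.Properties using (∈-++⁺ʳ; ∈-lookup)
  open import Data.List.Properties using (++-assoc; ++-identityʳ; length-++; length-map)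
  open import Data.List.Relation.Binary.Permutation.Propositional
    using (_↭_; ↭-refl; ↭-reflexive; ↭-trans; ↭-sym; swap; ↭⇒↭ₛ)
  open import Data.List.Relation.Binary.Permutation.Propositional.Properties
    using (shift; shifts; ↭-length; ++↭ʳ++; ++⁺ˡ; ++⁺ʳ)
  import Data.List.Relation.Binary.Permutation.Setoid.Properties as ↭ₛ
  import Data.List.Relation.Binary.Sublist.Propositional as Sublist
  import Data.List.Relation.Binary.Sublist.Propositional.Properties as Sublist
  open import Data.List.Relation.Binary.Subset.Propositional using (_⊆_)
  open import Data.List.Relation.Unary.All as All using (All; []; _∷_)
  import Data.List.Relation.Unary.All.Properties as All
  open import Data.List.Relation.Unary.AllPairs using ([]; _∷_)
  open import Data.List.Relation.Unary.Any using (here; there)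
  open import Data.List.Relation.Unary.Linked as Linked using (Linked; []; [-]; _∷_)
  open import Data.List.Relation.Unary.Unique.Propositional using (Unique)
  open import Data.Nat
  open import Data.Nat.Properties
  open import Data.Sum as Sum using (inj₁; inj₂)
  open import Function using (_∘_; id)
  open import Relation.Nullary
  open Budgets
  open Decidability using (selected?)

  private
    variable
      G H : FiniteGraph
      B B′ : Board
      c   : Colour
      t u v : ℕ

  hasEdge-mono : B ⊆ B′ → HasEdge B c u v → HasEdge B′ c u v
  hasEdge-mono B⊆B′ = Sum.map B⊆B′ B⊆B′

  strategy-suc : Strategy G H t B → Strategy G H (suc t) B
  strategy-suc (over o)               = over o
  strategy-suc (play u v u≢v unsel s) = play u v u≢v unsel (strategy-suc ∘ s)

  -- If the edge has been selected before, Builder already knows its colour and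
  -- skips the round; so Builder need not keep track of the selected edges.
  ask : u ≢ v → (∀ c {B′} → B ⊆ B′ → HasEdge B′ c u v → Strategy G H t B′) →
        Strategy G H (suc t) B
  ask {u} {v} {B} u≢v s with selected? B u v
  ... | yes (c , e) = strategy-suc (s c id e)
  ... | no unsel    = play u v u≢v unsel λ c → s c there (inj₁ (here refl))

  Path : Board → Colour → List ℕ → Set
  Path B c = Linked (HasEdge B c)

  path-mono : ∀ {xs} → B ⊆ B′ → Path B c xs → Path B′ c xs
  path-mono B⊆B′ = Linked.map (hasEdge-mono B⊆B′)

  -- Pieces are joined at their heads, so one of them is read backwards; the joining edge is the
  -- first edge of the second path.
  path-∷ʳ++ : ∀ {x} xs {ys} → Path B c (x ∷ xs) → Path B c (x ∷ ys) → Path B c ((x ∷ xs) ʳ++ ys)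
  path-∷ʳ++ []       _        q = q
  path-∷ʳ++ (_ ∷ xs) (e ∷ p) q = path-∷ʳ++ xs p (Sum.swap e ∷ q)

  path-lookup : ∀ {xs} → Path B c xs → ∀ i j → suc (toℕ i) ≡ toℕ j →
                HasEdge B c (lookup xs i) (lookup xs j)
  path-lookup (e ∷ p) Fin.zero    (Fin.suc Fin.zero) refl = e
  path-lookup (e ∷ p) (Fin.suc i) (Fin.suc j)        eq   = path-lookup p i j (suc-injective eq)
  path-lookup [-]     Fin.zero    Fin.zero           ()

  unique-lookup : ∀ {xs : List ℕ} → Unique xs → ∀ i j → lookup xs i ≡ lookup xs j → i ≡ j
  unique-lookup (x∉ ∷ un) Fin.zero    Fin.zero    eq = refl
  unique-lookup (x∉ ∷ un) Fin.zero    (Fin.suc j) eq = contradiction eq (All.lookup x∉ (∈-lookup j))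
  unique-lookup (x∉ ∷ un) (Fin.suc i) Fin.zero    eq = contradiction (sym eq) (All.lookup x∉ (∈-lookup i))
  unique-lookup (x∉ ∷ un) (Fin.suc i) (Fin.suc j) eq = cong Fin.suc (unique-lookup un i j eq)

  path⇒copy : ∀ {k xs} → Path B c xs → Unique xs → k ≤ length xs → HasCopy B c (P k)
  path⇒copy {B = B} {c = c} {k} {xs} p un k≤ =
    lookup xs ∘ ι
    , (λ eq → Fin.inject≤-injective k≤ k≤ _ _ (unique-lookup un _ _ eq))
    , λ { i j (inj₁ eq) → edge i j eq ; i j (inj₂ eq) → Sum.swap (edge j i eq) }
    where
    ι : Fin k → Fin (length xs)
    ι i = Fin.inject≤ i k≤
    edge : ∀ i j → suc (toℕ i) ≡ toℕ j → HasEdge B c (lookup xs (ι i)) (lookup xs (ι j))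
    edge i j eq = path-lookup p (ι i) (ι j)
      (trans (cong suc (Fin.toℕ-inject≤ i k≤)) (trans eq (sym (Fin.toℕ-inject≤ j k≤))))

  -- Disjointness of all paths in play is kept as uniqueness of one concatenated list, so moving
  -- vertices between paths is a permutation.
  unique-resp-↭ : {xs ys : List ℕ} → xs ↭ ys → Unique xs → Unique ys
  unique-resp-↭ = ↭ₛ.Unique-resp-↭ (setoid ℕ) ∘ ↭⇒↭ₛ

  unique-resp-⊇ : {xs ys : List ℕ} → xs Sublist.⊆ ys → Unique ys → Unique xs
  unique-resp-⊇ Sublist.[]         _          = []
  unique-resp-⊇ (_ Sublist.∷ʳ s)   (_ ∷ un)   = unique-resp-⊇ s un
  unique-resp-⊇ (refl Sublist.∷ s) (x∉ ∷ un)  = Sublist.All-resp-⊆ s x∉ ∷ unique-resp-⊇ s un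

  unique-++⁻ˡ : ∀ xs {ys : List ℕ} → Unique (xs ++ ys) → Unique xs
  unique-++⁻ˡ xs {ys} = unique-resp-⊇ (Sublist.++⁺ʳ ys Sublist.⊆-refl)

  unique-++⁻ʳ : ∀ xs {ys : List ℕ} → Unique (xs ++ ys) → Unique ys
  unique-++⁻ʳ xs = unique-resp-⊇ (Sublist.++⁺ˡ xs Sublist.⊆-refl)

  unique-head : ∀ {x y} {xs : List ℕ} → Unique (x ∷ xs) → y ∈ xs → x ≢ y
  unique-head (x∉ ∷ _) = All.lookup x∉

  ++-pull : ∀ xs ys {z : ℕ} {zs} → xs ++ ys ++ z ∷ zs ↭ z ∷ xs ++ ys ++ zs
  ++-pull xs ys {z} {zs} = ↭-trans (++⁺ˡ xs (shift z ys zs)) (shift z xs (ys ++ zs))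

  ++-join : ∀ (xs ys {zs} : List ℕ) → xs ++ ys ++ zs ↭ (xs ʳ++ ys) ++ zs
  ++-join xs ys {zs} =
    ↭-trans (↭-reflexive (sym (++-assoc xs ys zs))) (++⁺ʳ zs (++↭ʳ++ xs ys))

  abstract

    -- Avoiding the listed vertices is enough: `ask` copes with an edge that is already selected.
    fresh : List ℕ → ℕ
    fresh xs = suc (max 0 xs)

    unique-fresh : ∀ {xs} → Unique xs → Unique (fresh xs ∷ xs)
    unique-fresh {xs} un = All.map (λ x≤ eq → <⇒≢ (s≤s x≤) (sym eq)) (xs≤max 0 xs) ∷ un

  -- Stacks of blue paths.

  Piece : Set
  Piece = ℕ × List ℕ

  vertices : Piece → List ℕ
  vertices (x , xs) = x ∷ xs

  flatten : List Piece → List ℕ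
  flatten = concatMap vertices

  heads⊆flatten : ∀ S → map proj₁ S Sublist.⊆ flatten S
  heads⊆flatten []             = Sublist.[]
  heads⊆flatten ((x , xs) ∷ S) = refl Sublist.∷ Sublist.++⁺ˡ xs (heads⊆flatten S)

  record Stack (B : Board) (S : List Piece) : Set where
    constructor mkStack
    field
      spine  : Path B red (map proj₁ S)
      pieces : All (Path B blue ∘ vertices) S

  open Stack

  stack-mono : ∀ {S} → B ⊆ B′ → Stack B S → Stack B′ S
  stack-mono ι (mkStack sp ps) = mkStack (path-mono ι sp) (All.map (path-mono ι) ps)

  stack-pop : ∀ {S p} → Stack B (p ∷ S) → Stack B S
  stack-pop (mkStack sp (_ ∷ ps)) = mkStack (Linked.tail sp) ps

  Short : Piece → Set
  Short (_ , xs) = length xs ≤ 1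

  -- This limits to `2 * k` the vertices that a supply stack of fewer than `k` pieces can strand.
  length-flatten-short : ∀ {S} → All Short S → length (flatten S) ≤ 2 * length S
  length-flatten-short [] = z≤n
  length-flatten-short {(_ , xs) ∷ S} (sh ∷ shs) = begin
    suc (length (xs ++ flatten S))        ≡⟨ cong suc (length-++ xs) ⟩
    suc (length xs + length (flatten S))  ≤⟨ s≤s (+-mono-≤ sh (length-flatten-short shs)) ⟩
    2 + 2 * length S                      ≡⟨ *-suc 2 (length S) ⟨
    2 * suc (length S)                    ∎
    where open ≤-Reasoning

  module _ (k n : ℕ) where

    open Budget k n

    redWin : ∀ {xs} → Path B red xs → Unique xs → k ≤ length xs → Strategy (P k) (P n) t B
    redWin p un k≤ = over (inj₁ (path⇒copy p un k≤))

    blueWin : ∀ {xs} → Path B blue xs → Unique xs → n ≤ length xs → Strategy (P k) (P n) t B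
    blueWin p un n≤ = over (inj₂ (path⇒copy p un n≤))

    -- The extra `k` makes up for the vertices left on the red path at the end.
    Ample : List ℕ → Set
    Ample xs = Unique xs × n + k ≤ length xs

    ample-resp-↭ : ∀ {xs ys} → xs ↭ ys → Ample xs → Ample ys
    ample-resp-↭ xs↭ys (un , le) = unique-resp-↭ xs↭ys un , subst (n + k ≤_) (↭-length xs↭ys) le

    -- J consists of vertices that have been cut off the blue pieces M ∷ Qs.
    mergePieces : ∀ t {B} J M Qs → Path B red J → Path B blue M → All (Path B blue) Qs →
                  Ample (J ++ M ++ concat Qs) → MergeBudget t (length J) (length Qs) →
                  Strategy (P k) (P n) t B
    mergePieces t J M Qs pJ pM pQs amp bud with k ≤? length J
    mergePieces t J M Qs pJ pM pQs (un , _) bud | yes k≤ = redWin pJ (unique-++⁻ˡ J un) k≤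
    mergePieces t J M [] pJ pM pQs (un , le) bud | no k≰ =
      blueWin pM (unique-++⁻ˡ M (unique-++⁻ʳ J un))
        (merge-remainder (≰⇒> k≰) (≤-trans le (≤-reflexive
          (trans (length-++ J) (cong (length J +_) (cong length (++-identityʳ M)))))))
    mergePieces t J [] (Q ∷ Qs) pJ pM (pQ ∷ pQs) amp bud | no _ =
      mergePieces t J Q Qs pJ pQ pQs amp (merge-drop bud)
    mergePieces t J M@(_ ∷ _) ([] ∷ Qs) pJ pM (pQ ∷ pQs) amp bud | no _ =
      mergePieces t J M Qs pJ pM pQs amp (merge-drop bud)
    mergePieces t J (m ∷ M) ((q ∷ Q) ∷ Qs) pJ pM (pQ ∷ pQs) amp bud | no k≰
      with merge-2≤t (≰⇒> k≰) bud
    mergePieces (suc (suc t)) {B} [] (m ∷ M) ((q ∷ Q) ∷ Qs) pJ pM (pQ ∷ pQs) amp bud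
      | no k≰ | s≤s (s≤s _) =
      -- Without a red path a single edge between the heads settles the case; the second of the two
      -- budgeted rounds is waived.
      strategy-suc (ask (unique-head (proj₁ amp) (∈-++⁺ʳ M (here refl))) reply)
      where
      reply : ∀ c {B′} → B ⊆ B′ → HasEdge B′ c m q → Strategy (P k) (P n) t B′
      reply red ι e =
        mergePieces t [ m ] M ((q ∷ Q) ∷ Qs) [-] (Linked.tail (path-mono ι pM))
          (All.map (path-mono ι) (pQ ∷ pQs)) amp (merge-push bud)
      reply blue ι e =
        mergePieces t [] ((m ∷ M) ʳ++ (q ∷ Q)) Qs []
          (path-∷ʳ++ M (path-mono ι pM) (e ∷ path-mono ι pQ)) (All.map (path-mono ι) pQs)
          (ample-resp-↭ (++-join (m ∷ M) (q ∷ Q)) amp) (merge-join bud)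
    mergePieces (suc (suc t)) {B} (r ∷ J) (m ∷ M) ((q ∷ Q) ∷ Qs) pJ pM (pQ ∷ pQs) amp bud
      | no k≰ | s≤s (s≤s _) =
      ask (unique-head (proj₁ amp) (∈-++⁺ʳ J (here refl))) reply
      where
      reply₂ : ∀ {B′} → B ⊆ B′ → HasEdge B′ blue r m →
               ∀ c {B″} → B′ ⊆ B″ → HasEdge B″ c r q → Strategy (P k) (P n) t B″
      -- The head `q` is cut off its piece and becomes the new end of the red path.
      reply₂ ι₁ e₁ red {B″} ι₂ e₂ =
        mergePieces t (q ∷ r ∷ J) (m ∷ M) (Q ∷ Qs)
          (Sum.swap e₂ ∷ path-mono ι pJ) (path-mono ι pM)
          (Linked.tail (path-mono ι pQ) ∷ All.map (path-mono ι) pQs)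
          (ample-resp-↭ (++-pull (r ∷ J) (m ∷ M)) amp)
          (merge-push bud)
        where
        ι : B ⊆ B″
        ι = ι₂ ∘ ι₁
      -- Both answers are blue: `r` leaves the red path and links `m` to `q`.
      reply₂ ι₁ e₁ blue {B″} ι₂ e₂ =
        mergePieces t J ((m ∷ M) ʳ++ (r ∷ q ∷ Q)) Qs
          (Linked.tail (path-mono ι pJ))
          (path-∷ʳ++ M (path-mono ι pM) (Sum.swap (hasEdge-mono ι₂ e₁) ∷ e₂ ∷ path-mono ι pQ))
          (All.map (path-mono ι) pQs)
          (ample-resp-↭
            (↭-trans (↭-sym (++-pull J (m ∷ M))) (++⁺ˡ J (++-join (m ∷ M) (r ∷ q ∷ Q)))) amp)
          (merge-pop bud)
        where
        ι : B ⊆ B″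
        ι = ι₂ ∘ ι₁

      reply : ∀ c {B′} → B ⊆ B′ → HasEdge B′ c r m → Strategy (P k) (P n) (suc t) B′
      reply red ι e = strategy-suc
        (mergePieces t (m ∷ r ∷ J) M ((q ∷ Q) ∷ Qs)
          (Sum.swap e ∷ path-mono ι pJ) (Linked.tail (path-mono ι pM))
          (All.map (path-mono ι) (pQ ∷ pQs))
          (ample-resp-↭ (shift m (r ∷ J) _) amp)
          (merge-push bud))
      reply blue ι e =
        ask (unique-head (proj₁ amp) (∈-++⁺ʳ J (there (∈-++⁺ʳ M (here refl))))) (reply₂ ι e)

    stackWin : ∀ {S} → Stack B S → Unique (flatten S) → k ≤ length S → Strategy (P k) (P n) t B
    stackWin {S = S} st un k≤ = redWin (spine st) (unique-resp-⊇ (heads⊆flatten S) un)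
      (≤-trans k≤ (≤-reflexive (sym (length-map proj₁ S))))

    -- First stage: growing pieces with two stacks.

    supply : ∀ t {B} g us S T → Short (g , us) → All Short S →
             Stack B ((g , us) ∷ S) → Stack B T → Unique (flatten ((g , us) ∷ S) ++ flatten T) →
             length (flatten T) < n + k →
             GrowBudget 0 t (length T) (length (flatten T)) (length (flatten ((g , us) ∷ S))) →
             Strategy (P k) (P n) t B
    attach : ∀ t {B} L S T → Path B blue L → All Short S →
             Stack B S → Stack B T → Unique (L ++ flatten S ++ flatten T) →
             length (L ++ flatten T) < n + k → length (flatten S) ≤ 2 * k →
             GrowBudget 6 t (length T) (length (L ++ flatten T)) (length (flatten S)) →
             Strategy (P k) (P n) t B
    resupply : ∀ t {B} S T → All Short S →
               Stack B S → Stack B T → Unique (flatten S ++ flatten T) →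
               length (flatten T) < n + k →
               GrowBudget 0 t (length T) (length (flatten T)) (length (flatten S)) →
               Strategy (P k) (P n) t B

    resupply t []             T sh sS sT un v< bud =
      supply t (fresh (flatten T)) [] [] T z≤n [] (mkStack [-] ([-] ∷ [])) sT
        (unique-fresh un) v< (grow-root bud)
    resupply t ((g , us) ∷ S) T (sh ∷ shs) sS sT un v< bud =
      supply t g us S T sh shs sS sT un v< bud

    supply t {B} g us S T sh shs sS sT un v< bud with k ≤? suc (length S) | k ≤? length T
    ... | yes k≤ | _      = stackWin sS (unique-++⁻ˡ (flatten ((g , us) ∷ S)) un) k≤
    ... | no _   | yes k≤ = stackWin sT (unique-++⁻ʳ (flatten ((g , us) ∷ S)) un) k≤
    ... | no s≱  | no h≱  = step t us sh sS un bud
      where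
      size≤ : ∀ us → Short (g , us) → length (flatten ((g , us) ∷ S)) ≤ 2 * k
      size≤ us sh = ≤-trans (length-flatten-short {(g , us) ∷ S} (sh ∷ shs))
        (*-monoʳ-≤ 2 (<⇒≤ (≰⇒> s≱)))

      step : ∀ t us → Short (g , us) → Stack B ((g , us) ∷ S) →
             Unique (flatten ((g , us) ∷ S) ++ flatten T) →
             GrowBudget 0 t (length T) (length (flatten T)) (length (flatten ((g , us) ∷ S))) →
             Strategy (P k) (P n) t B
      step t us sh sS un bud with grow-1≤t v< (size≤ us sh) bud
      step (suc t) [] sh sS un bud | s≤s _ =
        ask (≢-sym (unique-head (unique-fresh un) (here refl))) reply
        where
        x = fresh (flatten ((g , []) ∷ S) ++ flatten T)

        reply : ∀ c {B′} → B ⊆ B′ → HasEdge B′ c g x → Strategy (P k) (P n) t B′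
        reply red ι e =
          supply t x [] ((g , []) ∷ S) T z≤n (sh ∷ shs)
            (mkStack (Sum.swap e ∷ path-mono ι (spine sS))
                     ([-] ∷ All.map (path-mono ι) (pieces sS)))
            (stack-mono ι sT) (unique-fresh un) v< (grow-supply bud)
        -- The fresh vertex goes behind `g`, which stays the head, so the red spine is unchanged.
        reply blue ι e =
          supply t g [ x ] S T ≤-refl shs
            (mkStack (path-mono ι (spine sS))
                     ((e ∷ [-]) ∷ All.map (path-mono ι) (All.tail (pieces sS))))
            (stack-mono ι sT) (unique-resp-↭ (swap x g ↭-refl) (unique-fresh un)) v<
            (grow-supply bud)
      step (suc t) (u ∷ []) sh sS un bud | s≤s _ =
        ask (≢-sym (unique-head (unique-fresh un) (here refl))) reply
        where
        x = fresh (flatten ((g , [ u ]) ∷ S) ++ flatten T)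

        unique : Unique (u ∷ g ∷ x ∷ flatten S ++ flatten T)
        unique = unique-resp-↭ (++↭ʳ++ (x ∷ g ∷ u ∷ []) _) (unique-fresh un)

        size : length (flatten S) ≤ 2 * k
        size = ≤-trans (m≤n+m _ 2) (size≤ [ u ] sh)

        newPath : ∀ {B′} → B ⊆ B′ → HasEdge B′ blue g x → Path B′ blue (u ∷ g ∷ x ∷ [])
        newPath ι e = Sum.swap (Linked.head (path-mono ι (All.head (pieces sS)))) ∷ e ∷ [-]

        reply : ∀ c {B′} → B ⊆ B′ → HasEdge B′ c g x → Strategy (P k) (P n) t B′
        reply red ι e =
          supply t x [] ((g , [ u ]) ∷ S) T z≤n (sh ∷ shs)
            (mkStack (Sum.swap e ∷ path-mono ι (spine sS))
                     ([-] ∷ All.map (path-mono ι) (pieces sS)))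
            (stack-mono ι sT) (unique-fresh un) v< (grow-supply bud)
        reply blue ι e with n + k ≤? 3 + length (flatten T)
        -- The second stage takes the new path and all stored pieces; the rest of the supply stack
        -- is abandoned.
        ... | yes v≥ = mergePieces t [] (u ∷ g ∷ x ∷ []) (map vertices T) [] (newPath ι e)
                (All.map⁺ (All.map (path-mono ι) (pieces sT)))
                (unique-resp-⊇ (Sublist.++⁺ (Sublist.⊆-refl {x = u ∷ g ∷ x ∷ []})
                                  (Sublist.++⁺ˡ (flatten S) Sublist.⊆-refl)) unique , v≥)
                (subst (MergeBudget t 0) (sym (length-map vertices T))
                  -- Fewer than `n + k` vertices were stored before, so three more overshoot by at
                  -- most two.
                  (grow⇒merge (+-monoʳ-≤ 2 v<) size (≰⇒> h≱) (grow-piece bud)))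
        ... | no v≱  = attach t (u ∷ g ∷ x ∷ []) S T (newPath ι e) shs
                (stack-pop (stack-mono ι sS)) (stack-mono ι sT) unique (≰⇒> v≱) size (grow-piece bud)
      step (suc t) (_ ∷ _ ∷ _) (s≤s ()) sS un bud | _

    attach t [] S T pL sh sS sT un v< g≤ bud = resupply t S T sh sS sT un v< (grow-drop bud)
    attach t (a ∷ as) S [] pL sh sS sT un v< g≤ bud =
      resupply t S [ (a , as) ] sh sS (mkStack [-] (pL ∷ []))
        (unique-resp-↭ (shifts (a ∷ as) (flatten S)) un) v< (grow-store bud)
    attach t (a ∷ as) S ((x , xs) ∷ T) pL sh sS sT un v< g≤ bud with grow-1≤t v< g≤ bud
    attach (suc t) {B} (a ∷ as) S ((x , xs) ∷ T) pL sh sS sT un v< g≤ bud | s≤s _ =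
      ask (≢-sym (unique-head un (∈-++⁺ʳ as (∈-++⁺ʳ (flatten S) (here refl))))) reply
      where
      reply : ∀ c {B′} → B ⊆ B′ → HasEdge B′ c x a → Strategy (P k) (P n) t B′
      reply red ι e =
        resupply t S ((a , as) ∷ (x , xs) ∷ T) sh (stack-mono ι sS)
          (mkStack (Sum.swap e ∷ path-mono ι (spine sT)) (All.map (path-mono ι) (pL ∷ pieces sT)))
          (unique-resp-↭ (shifts (a ∷ as) (flatten S)) un) v< (grow-push bud)
      reply blue ι e =
        -- The merged path has the far end of the popped piece as its head and is offered to the
        -- next stored piece.
        attach t ((x ∷ xs) ʳ++ (a ∷ as)) S T
          (path-∷ʳ++ xs (path-mono ι (All.head (pieces sT))) (e ∷ path-mono ι pL)) sh
          (stack-mono ι sS) (stack-pop (stack-mono ι sT))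
          (unique-resp-↭ (↭-trans (++⁺ˡ (a ∷ as) (shifts (flatten S) (x ∷ xs))) joined) un)
          (subst (_< n + k) (↭-length joined) v<) g≤
          (subst (λ v → GrowBudget 6 t (length T) v (length (flatten S))) (↭-length joined)
            (grow-pop bud))
        where
        joined : ∀ {zs} → (a ∷ as) ++ (x ∷ xs) ++ zs ↭ ((x ∷ xs) ʳ++ (a ∷ as)) ++ zs
        joined = ↭-trans (shifts (a ∷ as) (x ∷ xs)) (++-join (x ∷ xs) (a ∷ as))

  builderWins : ∀ k n t → 1 ≤ n + k → 5 * n + 36 * k ≤ 2 + 3 * t →
                BuilderWinsWithin (P k) (P n) t
  builderWins k n t pos le =
    supply k n t 0 [] [] [] z≤n [] (mkStack [-] ([-] ∷ [])) (mkStack [] []) ([] ∷ []) pos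
      (Budget.grow-start k n le)

-- The online size Ramsey number and its rational bound.

open import Data.Integer using (+_)
import Data.Integer as ℤ
import Data.Integer.Properties as ℤ
open import Data.Integer.Tactic.RingSolver using (solve-∀)
open import Data.Nat using (ℕ; _≥_)
import Data.Nat as ℕ
open import Data.Nat.DivMod using (m≡m%n+[m/n]*n; m%n<n; m/n*n≤m)
import Data.Nat.Properties as ℕ
open import Data.Rational.Unnormalised using (_/_; _+_; _*_; _≤_; *≤*)
open Decidability using (least; strategy?)
open BuilderStrategy using (builderWins)

bound⇒≤ : ∀ r n k → r ℕ.* 3 ℕ.≤ 5 ℕ.* n ℕ.+ 36 ℕ.* k →
          + r / 1 ≤ (+ 5 / 3) * (+ n / 1) + (+ 12 / 1) * (+ k / 1)
-- The order on fractions unfolds to an inequality of cross-multiplied integer numerators.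
bound⇒≤ r n k le = *≤* (subst₂ ℤ._≤_ (ℤ.pos-* r 3) rhs (ℤ.+≤+ le))
  where
  regroup : ∀ x y → + 5 ℤ.* x ℤ.+ + 36 ℤ.* y ≡ (+ 5 ℤ.* x ℤ.* + 1 ℤ.+ + 12 ℤ.* y ℤ.* + 3) ℤ.* + 1
  regroup = solve-∀

  rhs : + (5 ℕ.* n ℕ.+ 36 ℕ.* k) ≡ (+ 5 ℤ.* + n ℤ.* + 1 ℤ.+ + 12 ℤ.* + k ℤ.* + 3) ℤ.* + 1
  rhs = trans (trans (ℤ.pos-+ (5 ℕ.* n) (36 ℕ.* k)) (cong₂ ℤ._+_ (ℤ.pos-* 5 n) (ℤ.pos-* 36 k)))
          (regroup (+ n) (+ k))

theorem1p2 : (n k : ℕ) → n ≥ 1 → k ≥ 5 →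
    ∃ λ r → IsOnlineSizeRamsey (P k) (P n) r × + r / 1 ≤ (+ 5 / 3) * (+ n / 1) + (+ 12 / 1) * (+ k / 1)
theorem1p2 n k n≥1 k≥5 =
  let r , r≤t , wins , minimal =
        least (λ t → strategy? k n t []) t (builderWins k n t positive enough)
  in  r , (wins , minimal) , bound⇒≤ r n k (ℕ.≤-trans (ℕ.*-monoˡ-≤ 3 r≤t) (m/n*n≤m N 3))
  where
  N t : ℕ
  N = 5 ℕ.* n ℕ.+ 36 ℕ.* k
  -- Rounding down gives `3 * t ≤ N`; the remainder, at most 2, is the 2 allowed by `builderWins`.
  t = N ℕ./ 3

  positive : 1 ℕ.≤ n ℕ.+ k
  positive = ℕ.≤-trans n≥1 (ℕ.m≤m+n n k)

  enough : N ℕ.≤ 2 ℕ.+ 3 ℕ.* t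
  enough = ℕ.≤-trans (ℕ.≤-reflexive (m≡m%n+[m/n]*n N 3))
    (ℕ.+-mono-≤ (ℕ.≤-pred (m%n<n N 3)) (ℕ.≤-reflexive (ℕ.*-comm t 3)))
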